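{- Let $m, n$ be positive integers with $m \le n$, and let $K_{m,n}$ be the complete bipartite graph with parts of sizes $m$ and $n$. Then the regular number $r(K_{m,n})$ satisfies $$\left\lceil \frac{n}{m} \right\rceil \le r(K_{m,n}) \le \left\lfloor \frac{n}{m} \right\rfloor + m.$$ Moreover, if $m$ divides $n$, then $r(K_{m,n}) = n/m$.
   Context: All graphs are finite, simple and undirected. For a set $F$ of edges of a graph $G$, the subgraph induced by $F$, denoted $\langle F \rangle$, is the graph whose edge set is $F$ and whose vertex set is the set of endpoints of edges in $F$ (it need not contain all the vertices of $G$). The regular number $r(G)$ of a graph $G=(V,E)$ is the minimum number of nonempty subsets into which the edge set $E$ can be partitioned so that the subgraph induced by each subset is regular (i.e. all of its vertices have the same degree; different subsets may have different degrees of regularity, and the induced subgraphs need not be connected). -}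

module Defs where

open import Data.Fin.Base using (Fin; zero; suc; toℕ; _<_)
import Data.Fin.Properties as Fin
open import Data.Fin.Subset using (Subset; _∈_; ∣_∣; ⁅_⁆; ⊤)
open import Data.Fin.Subset.Properties
  using (_∈?_; nonempty?; anySubset?; ⊆-antisym; ∈⊤; x∈⁅x⁆; x∈⁅y⁆⇒x≡y; ∣⁅x⁆∣≡1)
open import Data.List.Base using (List; length; allFin; filter; cartesianProduct; lookup)
open import Data.List.Membership.Propositional using () renaming (_∈_ to _∈ˡ_)
open import Data.List.Membership.Propositional.Properties
  using (∈-allFin; ∈-cartesianProduct⁺; ∈-filter⁺; ∈-filter⁻; ∈-lookup)
import Data.List.Relation.Unary.All as All
open import Data.List.Relation.Unary.AllPairs using (_∷_)
open import Data.List.Relation.Unary.Any using (index)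
open import Data.List.Relation.Unary.Any.Properties using (lookup-index)
open import Data.List.Relation.Unary.Unique.Propositional using (Unique)
import Data.List.Relation.Unary.Unique.Propositional.Properties as Unique
open import Data.Nat.Base using (ℕ; suc; _+_; _≤_)
import Data.Nat.Base as ℕ
import Data.Nat.Properties as ℕ
open import Data.Nat.Induction using (<-rec)
open import Data.Product.Base using (Σ; ∃; ∃₂; ∃-syntax; _×_; _,_; proj₁; proj₂)
open import Data.Sum.Base using (_⊎_; inj₁; inj₂)
open import Data.Vec.Base using (tabulate)
open import Data.Vec.Properties using (lookup⇒[]=; []=⇒lookup; lookup∘tabulate; tabulate-cong)
open import Function.Base using (_∘_)
open import Relation.Binary.Core using (Rel)
open import Relation.Binary.Definitions
  using (Reflexive; tri<; tri≈; tri>)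
open import Relation.Binary.PropositionalEquality
  using (_≡_; _≢_; refl; sym; trans; cong; subst; subst₂)
open import Relation.Nullary
  using (¬_; Dec; yes; no; does; contradiction; _×-dec_; _⊎-dec_; _→-dec_)
open import Relation.Nullary.Decidable using (map′; dec-true)
open import Relation.Unary using (Pred; Decidable)
open import Level using (0ℓ)

private
  variable
    N k : ℕ

select : {P : Pred (Fin N) 0ℓ} → Decidable P → Subset N
select P? = tabulate (does ∘ P?)

module _ {P : Pred (Fin N) 0ℓ} (P? : Decidable P) where

  ∈-select⁺ : ∀ {x} → P x → x ∈ select P?
  ∈-select⁺ {x} px =
    lookup⇒[]= x _ (trans (lookup∘tabulate _ x) (dec-true (P? x) px))

  ∈-select⁻ : ∀ {x} → x ∈ select P? → P x
  ∈-select⁻ {x} x∈ with P? x | trans (sym (lookup∘tabulate (does ∘ P?) x)) ([]=⇒lookup x∈)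
  ... | yes px | _ = px

-- A finite set of edges (unordered pairs of distinct points of Fin N),
-- stored through neighbourhoods: {u, v} is an edge when v ∈ nbr u.
record EdgeSet (N : ℕ) : Set where
  field
    nbr    : Fin N → Subset N
    irrefl : ∀ u → ¬ (u ∈ nbr u)
    symm   : ∀ u v → v ∈ nbr u → u ∈ nbr v

open EdgeSet public

infix 4 _—_∈_ _⊆ᴱ_

_—_∈_ : Fin N → Fin N → EdgeSet N → Set
u — v ∈ F = v ∈ nbr F u

_⊆ᴱ_ : EdgeSet N → EdgeSet N → Set
F ⊆ᴱ F′ = ∀ u v → u — v ∈ F → u — v ∈ F′

Nonemptyᴱ : EdgeSet N → Set
Nonemptyᴱ F = ∃₂ λ u v → u — v ∈ F

-- The vertex set is a subset of Fin N rather than all of it, so that an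
-- edge-induced subgraph, which may omit vertices, is again a Graph N.
record Graph (N : ℕ) : Set where
  field
    V        : Subset N
    E        : EdgeSet N
    endpoint : ∀ u v → u — v ∈ E → u ∈ V

open Graph public

degree : Graph N → Fin N → ℕ
degree G u = ∣ nbr (E G) u ∣

Regular : Graph N → Set
Regular G = ∀ u v → u ∈ V G → v ∈ V G → degree G u ≡ degree G v

⟨_⟩ : EdgeSet N → Graph N
⟨ F ⟩ = record
  { V        = select (λ u → nonempty? (nbr F u))
  ; E        = F
  ; endpoint = λ u v uv → ∈-select⁺ (λ u → nonempty? (nbr F u)) (v , uv)
  }

record IsRegularPartition (G : Graph N) (F : Fin k → EdgeSet N) : Set where
  field
    subsets  : ∀ i → F i ⊆ᴱ E G
    nonempty : ∀ i → Nonemptyᴱ (F i)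
    disjoint : ∀ i j u v → u — v ∈ F i → u — v ∈ F j → i ≡ j
    covers   : ∀ u v → u — v ∈ E G → ∃[ i ] u — v ∈ F i
    regular  : ∀ i → Regular ⟨ F i ⟩

HasRegularPartition : Graph N → ℕ → Set
HasRegularPartition {N} G k = Σ (Fin k → EdgeSet N) (IsRegularPartition G)

IsRegularNumber : Graph N → ℕ → Set
IsRegularNumber G r =
  HasRegularPartition G r × (∀ k → HasRegularPartition G k → r ≤ k)

module _ (u v : Fin N) where

  SameEdge : Fin N → Fin N → Set
  SameEdge x y = (x ≡ u × y ≡ v) ⊎ (x ≡ v × y ≡ u)

  sameEdge? : ∀ x y → Dec (SameEdge x y)
  sameEdge? x y =
    (x Fin.≟ u ×-dec y Fin.≟ v) ⊎-dec (x Fin.≟ v ×-dec y Fin.≟ u)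

module _ {u v : Fin N} (u≢v : u ≢ v) where

  singleEdge : EdgeSet N
  singleEdge = record
    { nbr    = λ x → select (sameEdge? u v x)
    ; irrefl = λ x x∈ → irr (∈-select⁻ (sameEdge? u v x) x∈)
    ; symm   = λ x y xy →
        ∈-select⁺ (sameEdge? u v y) (sy (∈-select⁻ (sameEdge? u v x) xy))
    }
    where
    irr : ∀ {x} → ¬ SameEdge u v x x
    irr (inj₁ (refl , q)) = u≢v q
    irr (inj₂ (p , refl)) = u≢v p

    sy : ∀ {x y} → SameEdge u v x y → SameEdge u v y x
    sy (inj₁ (p , q)) = inj₂ (q , p)
    sy (inj₂ (p , q)) = inj₁ (q , p)

  ∈-singleEdge⁺ : ∀ x y → SameEdge u v x y → x — y ∈ singleEdge
  ∈-singleEdge⁺ x _ = ∈-select⁺ (sameEdge? u v x)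

  ∈-singleEdge⁻ : ∀ x y → x — y ∈ singleEdge → SameEdge u v x y
  ∈-singleEdge⁻ x _ = ∈-select⁻ (sameEdge? u v x)

  private
    unique : ∀ {x y z} → SameEdge u v x y → SameEdge u v x z → y ≡ z
    unique (inj₁ (refl , refl)) (inj₁ (_ , refl)) = refl
    unique (inj₁ (refl , refl)) (inj₂ (p , _))    = contradiction p u≢v
    unique (inj₂ (refl , refl)) (inj₁ (p , _))    = contradiction (sym p) u≢v
    unique (inj₂ (refl , refl)) (inj₂ (_ , refl)) = refl

    degree≡1 : ∀ x → x ∈ V ⟨ singleEdge ⟩ → degree ⟨ singleEdge ⟩ x ≡ 1
    degree≡1 x x∈ with ∈-select⁻ (λ x → nonempty? (nbr singleEdge x)) x∈
    ... | y , xy = trans (cong ∣_∣ (⊆-antisym nbr⇒ nbr⇐)) (∣⁅x⁆∣≡1 y)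
      where
      nbr⇒ : ∀ {z} → x — z ∈ singleEdge → z ∈ ⁅ y ⁆
      nbr⇒ xz = subst (_∈ ⁅ y ⁆) (unique (∈-singleEdge⁻ x y xy) (∈-singleEdge⁻ x _ xz)) (x∈⁅x⁆ y)

      nbr⇐ : ∀ {z} → z ∈ ⁅ y ⁆ → x — z ∈ singleEdge
      nbr⇐ z∈ = subst (x —_∈ singleEdge) (sym (x∈⁅y⁆⇒x≡y y z∈)) xy

  singleEdge-regular : Regular ⟨ singleEdge ⟩
  singleEdge-regular x y x∈ y∈ = trans (degree≡1 x x∈) (sym (degree≡1 y y∈))

private
  lookup-injective : ∀ {A : Set} {xs : List A} → Unique xs →
                     ∀ {i j} → lookup xs i ≡ lookup xs j → i ≡ j
  lookup-injective (_ ∷ _)   {zero}  {zero}  _  = refl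
  lookup-injective (x∉ ∷ _)  {zero}  {suc j} eq = contradiction eq (All.lookup x∉ (∈-lookup j))
  lookup-injective (x∉ ∷ _)  {suc i} {zero}  eq = contradiction (sym eq) (All.lookup x∉ (∈-lookup i))
  lookup-injective (_ ∷ xs!) {suc i} {suc j} eq = cong suc (lookup-injective xs! eq)

-- One class for each edge.
hasRegularPartition : (G : Graph N) → ∃ (HasRegularPartition G)
hasRegularPartition {N} G = length edges , F , record
  { subsets  = λ i x y xy → sub i (∈-singleEdge⁻ (distinct i) x y xy)
  ; nonempty = λ i → proj₁ (lookup edges i) , proj₂ (lookup edges i) ,
      ∈-singleEdge⁺ (distinct i) _ _ (inj₁ (refl , refl))
  ; disjoint = λ i j x y p q → lookup-injective edges!
      (same i j (∈-singleEdge⁻ (distinct i) x y p) (∈-singleEdge⁻ (distinct j) x y q))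
  ; covers   = cov
  ; regular  = λ i → singleEdge-regular (distinct i)
  }
  where
  IsEdge : Pred (Fin N × Fin N) 0ℓ
  IsEdge (u , v) = u < v × u — v ∈ E G

  isEdge? : Decidable IsEdge
  isEdge? (u , v) = u Fin.<? v ×-dec v ∈? nbr (E G) u

  pairs edges : List (Fin N × Fin N)
  pairs = cartesianProduct (allFin N) (allFin N)
  edges = filter isEdge? pairs

  edges! : Unique edges
  edges! = Unique.filter⁺ isEdge? (Unique.cartesianProduct⁺ (Unique.allFin⁺ N) (Unique.allFin⁺ N))

  isEdge : ∀ i → IsEdge (lookup edges i)
  isEdge i = proj₂ (∈-filter⁻ isEdge? {xs = pairs} (∈-lookup i))

  distinct : ∀ i → proj₁ (lookup edges i) ≢ proj₂ (lookup edges i)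
  distinct i = Fin.<⇒≢ (proj₁ (isEdge i))

  F : Fin (length edges) → EdgeSet N
  F i = singleEdge (distinct i)

  sub : ∀ i {x y} → SameEdge (proj₁ (lookup edges i)) (proj₂ (lookup edges i)) x y → x — y ∈ E G
  sub i (inj₁ (refl , refl)) = proj₂ (isEdge i)
  sub i (inj₂ (refl , refl)) = symm (E G) _ _ (proj₂ (isEdge i))

  same : ∀ i j {x y} →
         SameEdge (proj₁ (lookup edges i)) (proj₂ (lookup edges i)) x y →
         SameEdge (proj₁ (lookup edges j)) (proj₂ (lookup edges j)) x y →
         lookup edges i ≡ lookup edges j
  same i j p q with lookup edges i | lookup edges j | isEdge i | isEdge j
  same i j (inj₁ (refl , refl)) (inj₁ (refl , refl)) | _ | _ | _       | _       = refl
  same i j (inj₁ (refl , refl)) (inj₂ (refl , refl)) | _ | _ | lt , _  | lt′ , _ = contradiction lt′ (Fin.<-asym lt)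
  same i j (inj₂ (refl , refl)) (inj₁ (refl , refl)) | _ | _ | lt , _  | lt′ , _ = contradiction lt′ (Fin.<-asym lt)
  same i j (inj₂ (refl , refl)) (inj₂ (refl , refl)) | _ | _ | _       | _       = refl

  find : ∀ {u v} → u < v → u — v ∈ E G → ∃[ i ] (u , v) ≡ lookup edges i
  find {u} {v} u<v uv = index mem , lookup-index mem
    where
    mem : (u , v) ∈ˡ edges
    mem = ∈-filter⁺ isEdge? (∈-cartesianProduct⁺ (∈-allFin u) (∈-allFin v)) (u<v , uv)

  cov : ∀ u v → u — v ∈ E G → ∃[ i ] u — v ∈ F i
  cov u v uv with Fin.<-cmp u v
  ... | tri< u<v _ _ = let i , eq = find u<v uv in
        i , ∈-singleEdge⁺ (distinct i) u v (inj₁ (cong proj₁ eq , cong proj₂ eq))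
  ... | tri≈ _ refl _ = contradiction uv (irrefl (E G) u)
  ... | tri> _ _ v<u = let i , eq = find v<u (symm (E G) u v uv) in
        i , ∈-singleEdge⁺ (distinct i) u v (inj₂ (cong proj₂ eq , cong proj₁ eq))

-- Exhaustive search over A. Function extensionality is unavailable, so
-- the predicate has to respect the given equality.
private
  Searchable : {A : Set} → Rel A 0ℓ → Set₁
  Searchable {A} _~_ = {P : Pred A 0ℓ} → (∀ {x y} → x ~ y → P x → P y) →
                       Decidable P → Dec (∃ P)

  Pointwise : {A : Set} → Rel A 0ℓ → Rel (Fin k → A) 0ℓ
  Pointwise _~_ f g = ∀ i → f i ~ g i

  cons : {A : Set} → A → (Fin k → A) → Fin (suc k) → A
  cons a f zero    = a
  cons a f (suc i) = f i

  empty : {A : Set} → Fin 0 → A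
  empty ()

  search-→ : {A : Set} {_~_ : Rel A 0ℓ} → Reflexive _~_ → Searchable _~_ →
             ∀ k → Searchable (Pointwise {k} _~_)
  search-→ rfl s ℕ.zero resp P? =
    map′ (empty ,_) (λ (_ , p) → resp (λ ()) p) (P? empty)
  search-→ {A} {_~_} rfl s (suc k) {P} resp P? =
    map′ (λ (a , f , p) → cons a f , p)
         (λ (f , p) → f zero , f ∘ suc , resp (λ { zero → rfl ; (suc i) → rfl }) p)
         (s {λ a → ∃[ f ] P (cons a f)}
            (λ a~b (f , p) → f , resp (λ { zero → a~b ; (suc i) → rfl }) p)
            (λ a → search-→ rfl s k
               (λ f~g → resp (λ { zero → rfl ; (suc i) → f~g i }))
               (λ f → P? (cons a f))))

  _≈ᴱ_ : Rel (EdgeSet N) 0ℓ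
  F ≈ᴱ F′ = ∀ u → nbr F u ≡ nbr F′ u

  IsEdgeSet : (Fin N → Subset N) → Set
  IsEdgeSet f = (∀ u → ¬ (u ∈ f u)) × (∀ u v → v ∈ f u → u ∈ f v)

  isEdgeSet? : Decidable (IsEdgeSet {N})
  isEdgeSet? f =
    Fin.all? (λ u → (u ∈? f u) →-dec no (λ ())) ×-dec
    Fin.all? (λ u → Fin.all? λ v → (v ∈? f u) →-dec (u ∈? f v))

  toEdgeSet : (f : Fin N → Subset N) → IsEdgeSet f → EdgeSet N
  toEdgeSet f (i , s) = record { nbr = f ; irrefl = i ; symm = s }

  search-EdgeSet : Searchable (_≈ᴱ_ {N})
  search-EdgeSet {N} {P} resp P? =
    map′ (λ (f , ok , p) → toEdgeSet f ok , p)
         (λ (F , p) → nbr F , (irrefl F , symm F) , resp (λ _ → refl) p)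
         (search-→ {_~_ = _≡_} refl (λ _ → anySubset?) N {λ f → Σ (IsEdgeSet f) (P ∘ toEdgeSet f)}
            (λ {f} {g} f~g (ok , p) → transport f~g ok , resp f~g p)
            dec)
    where
    transport : ∀ {f g : Fin N → Subset N} → (∀ u → f u ≡ g u) → IsEdgeSet f → IsEdgeSet g
    transport f~g (i , s) =
      (λ u u∈ → i u (subst (u ∈_) (sym (f~g u)) u∈)) ,
      (λ u v v∈ → subst (u ∈_) (f~g v) (s u v (subst (v ∈_) (sym (f~g u)) v∈)))

    dec : Decidable (λ f → Σ (IsEdgeSet f) (P ∘ toEdgeSet f))
    dec f with isEdgeSet? f
    ... | no ¬ok = no (¬ok ∘ proj₁)
    ... | yes ok = map′ (ok ,_) (λ (ok′ , p) → resp (λ _ → refl) p) (P? (toEdgeSet f ok))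

  isRegularPartition-resp : (G : Graph N) {F F′ : Fin k → EdgeSet N} →
    (∀ i → F i ≈ᴱ F′ i) → IsRegularPartition G F → IsRegularPartition G F′
  isRegularPartition-resp {N} G {F} {F′} F≈F′ P = record
    { subsets  = λ i u v → subsets i u v ∘ from i
    ; nonempty = λ i → let u , v , uv = nonempty i in u , v , to i uv
    ; disjoint = λ i j u v p q → disjoint i j u v (from i p) (from j q)
    ; covers   = λ u v uv → let i , p = covers u v uv in i , to i p
    ; regular  = λ i u v u∈ v∈ →
        subst₂ _≡_ (cong ∣_∣ (F≈F′ i u)) (cong ∣_∣ (F≈F′ i v))
          (regular i u v (fromV i u∈) (fromV i v∈))
    }
    where
    open IsRegularPartition P
    to : ∀ i {u v} → u — v ∈ F i → u — v ∈ F′ i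
    to i {u} {v} = subst (v ∈_) (F≈F′ i u)
    from : ∀ i {u v} → u — v ∈ F′ i → u — v ∈ F i
    from i {u} {v} = subst (v ∈_) (sym (F≈F′ i u))
    fromV : ∀ i {u} → u ∈ V ⟨ F′ i ⟩ → u ∈ V ⟨ F i ⟩
    fromV i {u} = subst (u ∈_)
      (tabulate-cong (λ w → cong (does ∘ nonempty?) (sym (F≈F′ i w))))

isRegularPartition? : (G : Graph N) (F : Fin k → EdgeSet N) → Dec (IsRegularPartition G F)
isRegularPartition? G F =
  map′ (λ (s , n , d , c , r) → record
         { subsets = s ; nonempty = n ; disjoint = d
         ; covers = c ; regular = r })
       (λ P → let open IsRegularPartition P in
         subsets , nonempty , disjoint , covers , regular)
       ((Fin.all? λ i → Fin.all? λ u → Fin.all? λ v →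
           v ∈? nbr (F i) u →-dec v ∈? nbr (E G) u)
        ×-dec (Fin.all? λ i → Fin.any? λ u → Fin.any? λ v → v ∈? nbr (F i) u)
        ×-dec (Fin.all? λ i → Fin.all? λ j → Fin.all? λ u → Fin.all? λ v →
           v ∈? nbr (F i) u →-dec (v ∈? nbr (F j) u →-dec i Fin.≟ j))
        ×-dec (Fin.all? λ u → Fin.all? λ v →
           v ∈? nbr (E G) u →-dec Fin.any? λ i → v ∈? nbr (F i) u)
        ×-dec (Fin.all? λ i → Fin.all? λ u → Fin.all? λ v →
           u ∈? V ⟨ F i ⟩ →-dec (v ∈? V ⟨ F i ⟩ →-dec
             degree ⟨ F i ⟩ u ℕ.≟ degree ⟨ F i ⟩ v)))

hasRegularPartition? : (G : Graph N) → Decidable (HasRegularPartition G)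
hasRegularPartition? G k =
  search-→ {_~_ = _≈ᴱ_} (λ _ → refl) search-EdgeSet k (isRegularPartition-resp G) (isRegularPartition? G)

private
  least : {P : Pred ℕ 0ℓ} → Decidable P → ∀ n → P n → ∃[ r ] P r × (∀ k → P k → r ≤ k)
  least {P} P? = <-rec _ λ n rec pn → step n rec pn
    where
    step : ∀ n → (∀ {m} → m ℕ.< n → P m → ∃[ r ] P r × (∀ k → P k → r ≤ k)) →
           P n → ∃[ r ] P r × (∀ k → P k → r ≤ k)
    step n rec pn with ℕ.anyUpTo? P? n
    ... | yes (m , m<n , pm) = rec m<n pm
    ... | no ¬lt = n , pn , λ k pk → ℕ.≮⇒≥ (λ k<n → ¬lt (k , k<n , pk))

∃-regularNumber : (G : Graph N) → ∃ (IsRegularNumber G)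
∃-regularNumber G =
  let k , p = hasRegularPartition G in least (hasRegularPartition? G) k p

regularNumber : Graph N → ℕ
regularNumber G = proj₁ (∃-regularNumber G)

regularNumber-isRegularNumber : (G : Graph N) → IsRegularNumber G (regularNumber G)
regularNumber-isRegularNumber G = proj₂ (∃-regularNumber G)

-- The parts are {0, …, m - 1} and {m, …, m + n - 1}.
module _ (m n : ℕ) where

  Opposite : Fin (m + n) → Fin (m + n) → Set
  Opposite u v = (toℕ u ℕ.< m × m ≤ toℕ v) ⊎ (m ≤ toℕ u × toℕ v ℕ.< m)

  opposite? : ∀ u v → Dec (Opposite u v)
  opposite? u v = (toℕ u ℕ.<? m ×-dec m ℕ.≤? toℕ v) ⊎-dec (m ℕ.≤? toℕ u ×-dec toℕ v ℕ.<? m)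

  K : Graph (m + n)
  K = record
    { V        = ⊤
    ; E        = record
      { nbr    = λ u → select (opposite? u)
      ; irrefl = λ u u∈ → irr (∈-select⁻ (opposite? u) u∈)
      ; symm   = λ u v uv → ∈-select⁺ (opposite? v) (sy (∈-select⁻ (opposite? u) uv))
      }
    ; endpoint = λ _ _ _ → ∈⊤
    }
    where
    irr : ∀ {u} → ¬ Opposite u u
    irr (inj₁ (u<m , m≤u)) = ℕ.<⇒≱ u<m m≤u
    irr (inj₂ (m≤u , u<m)) = ℕ.<⇒≱ u<m m≤u

    sy : ∀ {u v} → Opposite u v → Opposite v u
    sy (inj₁ (p , q)) = inj₂ (q , p)
    sy (inj₂ (p , q)) = inj₁ (q , p)

{-# OPTIONS --safe #-}

-- Lower bound: a nonempty regular subgraph of K m n has equally many vertices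
-- in both parts, hence at most m in the part of size n, while the classes
-- together meet every vertex of that part.
-- Upper bound: with q = ⌊n/m⌋, cut the part of size n into q blocks of size m,
-- each spanning a copy of K m m, and fewer than m remaining vertices b.  The
-- edges ab at the latter split into the m matchings given by (a + b) mod m.

module Submission where

open import Defs
open import Data.Nat.Base using (ℕ; NonZero; _≤_)
open import Data.Nat.Divisibility using (_∣_)
open import Data.Integer.Base as ℤ using (+_)
open import Data.Rational.Unnormalised.Base using (_/_; _≃_; floor; ceiling)
open import Data.Product.Base using (_×_)

open import Data.Bool.Base using (Bool; true; false; if_then_else_)
open import Data.Empty using (⊥)
open import Data.Fin.Base using (Fin; zero; suc; toℕ; fromℕ<; splitAt; join; _↑ˡ_; _↑ʳ_)
import Data.Fin.Properties as Fin
open import Data.Fin.Subset using (Subset; inside; outside; _∈_; ∣_∣)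
open import Data.Fin.Subset.Properties using (nonempty?; x∈p⇒∣p-x∣<∣p∣)
import Data.Integer.Properties as ℤ
import Data.Integer.DivMod as ℤ
open import Data.Nat.Base as ℕ using (_+_; _*_; _%_; _<_; suc; z≤n; ∣_-_∣)
open import Data.Nat.DivMod
  using (m≡m%n+[m/n]*n; m%n<n; m<n⇒m%n≡m; [m+kn]%n≡m%n; m/n*n≤m; m/n*n≡m; m*n/n≡m;
         m<n⇒m/n≡0; m<n*o⇒m/o<n; /-monoˡ-≤; +-distrib-/-∣ʳ)
open import Data.Nat.Divisibility using (divides; _∣?_; n∣m*n)
import Data.Nat.Properties as ℕ
open import Data.Product.Base using (∃-syntax; _,_; proj₁; proj₂)
open import Data.Rational.Unnormalised.Base using (*≡*)
open import Data.Sum.Base using (_⊎_; inj₁; inj₂)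
open import Data.Sum.Properties using (inj₁-injective; inj₂-injective)
open import Data.Vec.Base using (lookup; []; _∷_; here; there)
open import Data.Vec.Properties using (lookup⇒[]=; []=⇒lookup)
open import Function.Base using (_∘_; id)
open import Relation.Binary.PropositionalEquality
open import Relation.Nullary using (¬_; Dec; yes; no; contradiction)
open import Algebra.Properties.Semiring.Sum ℕ.+-*-semiring
  using (sum; sum-cong-≗; ∑-comm; *-distribˡ-sum)

-- Double counting

sum-mono-≤ : ∀ {n} {f g : Fin n → ℕ} → (∀ i → f i ≤ g i) → sum f ≤ sum g
sum-mono-≤ {ℕ.zero} f≤g = z≤n
sum-mono-≤ {suc n}  f≤g = ℕ.+-mono-≤ (f≤g zero) (sum-mono-≤ (f≤g ∘ suc))

sum-const : ∀ n c → sum {n} (λ _ → c) ≡ n * c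
sum-const ℕ.zero  c = refl
sum-const (suc n) c = cong (c ℕ.+_) (sum-const n c)

sum-splitAt : ∀ m {n} (f : Fin (m + n) → ℕ) →
  sum f ≡ sum (f ∘ (_↑ˡ n)) + sum (f ∘ (m ↑ʳ_))
sum-splitAt ℕ.zero  f = refl
sum-splitAt (suc m) f =
  trans (cong (f zero ℕ.+_) (sum-splitAt m (f ∘ suc))) (sym (ℕ.+-assoc (f zero) _ _))

term≤sum : ∀ {n} (f : Fin n → ℕ) i → f i ≤ sum f
term≤sum f zero    = ℕ.m≤m+n _ _
term≤sum f (suc i) = ℕ.≤-trans (term≤sum (f ∘ suc) i) (ℕ.m≤n+m _ _)

-- Both counts of the lower bound have this shape: rows bounded below, columns bounded above,
-- compared by interchanging the two sums.
doubleCounting : ∀ {p q} (f : Fin p → Fin q → ℕ) {r : Fin p → ℕ} {c : Fin q → ℕ} →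
  (∀ i → r i ≤ sum (f i)) → (∀ j → sum (λ i → f i j) ≤ c j) → sum r ≤ sum c
doubleCounting f {r} {c} r≤ ≤c = begin
  sum r                             ≤⟨ sum-mono-≤ r≤ ⟩
  sum (λ i → sum (f i))             ≡⟨ ∑-comm f ⟩
  sum (λ j → sum (λ i → f i j))     ≤⟨ sum-mono-≤ ≤c ⟩
  sum c                             ∎
  where open ℕ.≤-Reasoning

-- Cardinalities of subsets as sums of indicators

fromBool : Bool → ℕ
fromBool b = if b then 1 else 0

indicator : ∀ {N} → Subset N → Fin N → ℕ
indicator p x = fromBool (lookup p x)

∈⇒indicator≡1 : ∀ {N} {p : Subset N} {x} → x ∈ p → indicator p x ≡ 1
∈⇒indicator≡1 x∈p = cong fromBool ([]=⇒lookup x∈p)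

∉⇒indicator≡0 : ∀ {N} {p : Subset N} {x} → ¬ x ∈ p → indicator p x ≡ 0
∉⇒indicator≡0 {p = p} {x} x∉p with lookup p x in eq
... | true  = contradiction (lookup⇒[]= x p eq) x∉p
... | false = refl

indicator-cong : ∀ {N N′} {p : Subset N} {q : Subset N′} {x y} →
  (x ∈ p → y ∈ q) → (y ∈ q → x ∈ p) → indicator p x ≡ indicator q y
indicator-cong {p = p} {q} {x} {y} to from with lookup p x in eq
... | true  = sym (∈⇒indicator≡1 (to (lookup⇒[]= x p eq)))
... | false = sym (∉⇒indicator≡0 λ y∈q →
  contradiction (trans (sym eq) ([]=⇒lookup (from y∈q))) λ ())

∣p∣≡sum : ∀ {N} (p : Subset N) → ∣ p ∣ ≡ sum (indicator p)
∣p∣≡sum []            = refl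
∣p∣≡sum (outside ∷ p) = ∣p∣≡sum p
∣p∣≡sum (inside  ∷ p) = cong suc (∣p∣≡sum p)

-- Cardinalities by explicit enumeration

record Enumeration {A : Set} (d : ℕ) (P : A → Set) : Set where
  field
    element   : Fin d → A
    -- Only elements are compared, never proofs of `P`, so an element counts once however many
    -- proofs it has.
    injective : ∀ {s t} → element s ≡ element t → s ≡ t
    sound     : ∀ t → P (element t)
    complete  : ∀ {x} → P x → ∃[ t ] element t ≡ x

open Enumeration

-- Sending each element to its position in the other enumeration is injective in both directions,
-- which forces equal finite sizes.
size-unique : ∀ {A : Set} {P : A → Set} {d e} → Enumeration d P → Enumeration e P → d ≡ e
size-unique D D′ = Fin.cantor-schröder-bernstein (inj D D′) (inj D′ D)
  where
  index : ∀ {A : Set} {P : A → Set} {d e} → Enumeration d P → Enumeration e P → Fin d → Fin e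
  index D D′ t = proj₁ (complete D′ (sound D t))

  inj : ∀ {A : Set} {P : A → Set} {d e} (D : Enumeration d P) (D′ : Enumeration e P) →
        ∀ {s t} → index D D′ s ≡ index D D′ t → s ≡ t
  inj D D′ {s} {t} eq = injective D (trans (sym (proj₂ (complete D′ (sound D s))))
    (trans (cong (element D′) eq) (proj₂ (complete D′ (sound D t)))))

enumerate : ∀ {N} (p : Subset N) → Enumeration ∣ p ∣ (_∈ p)
enumerate [] = record
  { element = λ () ; injective = λ { {()} } ; sound = λ () ; complete = λ () }
enumerate (outside ∷ p) = record
  { element   = suc ∘ element D
  ; injective = injective D ∘ Fin.suc-injective
  ; sound     = there ∘ sound D
  ; complete  = λ { (there x∈p) → let t , eq = complete D x∈p in t , cong suc eq }
  }
  where D = enumerate p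
enumerate (inside ∷ p) = record
  { element   = λ { zero → zero ; (suc t) → suc (element D t) }
  ; injective = λ { {zero}  {zero}  _  → refl
                  ; {suc s} {suc t} eq → cong suc (injective D (Fin.suc-injective eq)) }
  ; sound     = λ { zero → here ; (suc t) → there (sound D t) }
  ; complete  = λ { here        → zero , refl
                  ; (there x∈p) → let t , eq = complete D x∈p in suc t , cong suc eq }
  }
  where D = enumerate p

-- This is how degrees in a colour class are computed: from an explicit list of the neighbours.
∣select∣ : ∀ {N d} {P : Fin N → Set} (P? : ∀ x → Dec (P x)) → Enumeration d P → ∣ select P? ∣ ≡ d
∣select∣ P? D = size-unique (enumerate (select P?)) record
  { element   = element D
  ; injective = injective D
  ; sound     = ∈-select⁺ P? ∘ sound D
  ; complete  = complete D ∘ ∈-select⁻ P?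
  }

-- The lower bound

module _ {m n : ℕ} where

  opposite-↑ : ∀ a b → Opposite m n (a ↑ˡ n) (m ↑ʳ b)
  opposite-↑ a b =
    inj₁ ( subst (_< m) (sym (Fin.toℕ-↑ˡ a n)) (Fin.toℕ<n a)
         , subst (m ≤_) (sym (Fin.toℕ-↑ʳ m b)) (ℕ.m≤m+n m _))

  ¬opposite-↑ʳ : ∀ b b′ → ¬ Opposite m n (m ↑ʳ b) (m ↑ʳ b′)
  ¬opposite-↑ʳ b b′ (inj₁ (lt , _)) =
    ℕ.m+n≮m m (toℕ b) (subst (_< m) (Fin.toℕ-↑ʳ m b) lt)
  ¬opposite-↑ʳ b b′ (inj₂ (_ , lt)) =
    ℕ.m+n≮m m (toℕ b′) (subst (_< m) (Fin.toℕ-↑ʳ m b′) lt)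

  ¬opposite-↑ˡ : ∀ a a′ → ¬ Opposite m n (a ↑ˡ n) (a′ ↑ˡ n)
  ¬opposite-↑ˡ a a′ (inj₁ (_ , le)) =
    ℕ.<⇒≱ (Fin.toℕ<n a′) (subst (m ≤_) (Fin.toℕ-↑ˡ a′ n) le)
  ¬opposite-↑ˡ a a′ (inj₂ (le , _)) =
    ℕ.<⇒≱ (Fin.toℕ<n a) (subst (m ≤_) (Fin.toℕ-↑ˡ a n) le)

  -- Count the edges of `F`, with `d` the common degree. Each right vertex of `⟨ F ⟩` lies on
  -- exactly `d` of them and each of the `m` left vertices on at most `d`; the factor `d` cancels
  -- because `F` has an edge.
  regular⇒∣V∩right∣≤m : (F : EdgeSet (m + n)) → F ⊆ᴱ E (K m n) → Nonemptyᴱ F →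
    Regular ⟨ F ⟩ → sum (λ b → indicator (V ⟨ F ⟩) (m ↑ʳ b)) ≤ m
  regular⇒∣V∩right∣≤m F F⊆K (u₀ , v₀ , u₀v₀) reg =
    ℕ.*-cancelˡ-≤ d {{ℕ.>-nonZero d>0}} (begin
      d * sum (λ b → indicator (V ⟨ F ⟩) (m ↑ʳ b))    ≡⟨ *-distribˡ-sum d (λ b → indicator (V ⟨ F ⟩) (m ↑ʳ b)) ⟩
      sum (λ b → d * indicator (V ⟨ F ⟩) (m ↑ʳ b))    ≤⟨ doubleCounting edge rows columns ⟩
      sum {m} (λ _ → d)                               ≡⟨ sum-const m d ⟩
      m * d                                           ≡⟨ ℕ.*-comm m d ⟩
      d * m                                           ∎)
    where
    open ℕ.≤-Reasoning
    d = degree ⟨ F ⟩ u₀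

    d>0 : 0 < d
    d>0 = ℕ.≤-<-trans z≤n (x∈p⇒∣p-x∣<∣p∣ u₀v₀)

    hasNeighbour? = λ u → nonempty? (nbr F u)

    degree≡d : ∀ {u v} → u — v ∈ F → degree ⟨ F ⟩ u ≡ d
    degree≡d {u} uv = reg u u₀ (∈-select⁺ hasNeighbour? (_ , uv)) (∈-select⁺ hasNeighbour? (_ , u₀v₀))

    edge : Fin n → Fin m → ℕ
    edge b a = indicator (nbr F (m ↑ʳ b)) (a ↑ˡ n)

    -- `F` has no edge inside the right part, so the right half of the sum vanishes.
    degree-right : ∀ b → degree ⟨ F ⟩ (m ↑ʳ b) ≡ sum (edge b)
    degree-right b = begin-equality
      ∣ nbr F (m ↑ʳ b) ∣                 ≡⟨ ∣p∣≡sum (nbr F (m ↑ʳ b)) ⟩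
      sum (indicator (nbr F (m ↑ʳ b)))   ≡⟨ sum-splitAt m (indicator (nbr F (m ↑ʳ b))) ⟩
      sum (edge b) + sum (indicator (nbr F (m ↑ʳ b)) ∘ (m ↑ʳ_))
        ≡⟨ cong (sum (edge b) ℕ.+_) (sum-cong-≗ λ b′ → ∉⇒indicator≡0 λ bb′ →
             ¬opposite-↑ʳ b b′ (∈-select⁻ (opposite? m n (m ↑ʳ b)) (F⊆K _ _ bb′))) ⟩
      sum (edge b) + sum {n} (λ _ → 0)   ≡⟨ cong (sum (edge b) ℕ.+_) (trans (sum-const n 0) (ℕ.*-zeroʳ n)) ⟩
      sum (edge b) + 0                   ≡⟨ ℕ.+-identityʳ _ ⟩
      sum (edge b)                       ∎

    rows : ∀ b → d * indicator (V ⟨ F ⟩) (m ↑ʳ b) ≤ sum (edge b)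
    rows b with lookup (V ⟨ F ⟩) (m ↑ʳ b) in eq
    ... | false = subst (_≤ sum (edge b)) (sym (ℕ.*-zeroʳ d)) z≤n
    ... | true  =
      let _ , uv = ∈-select⁻ hasNeighbour? (lookup⇒[]= (m ↑ʳ b) (V ⟨ F ⟩) eq)
      in ℕ.≤-reflexive (trans (ℕ.*-identityʳ d) (trans (sym (degree≡d uv)) (degree-right b)))

    -- Regularity constrains only the vertices of `⟨ F ⟩`. A left vertex may lie outside it and then
    -- has degree 0, hence an inequality.
    degree≤d : ∀ u → degree ⟨ F ⟩ u ≤ d
    degree≤d u with nonempty? (nbr F u)
    ... | yes (_ , uv) = ℕ.≤-reflexive (degree≡d uv)
    ... | no ¬uv = begin
      ∣ nbr F u ∣                 ≡⟨ ∣p∣≡sum (nbr F u) ⟩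
      sum (indicator (nbr F u))   ≡⟨ sum-cong-≗ (λ v → ∉⇒indicator≡0 λ uv → ¬uv (v , uv)) ⟩
      sum {m + n} (λ _ → 0)       ≡⟨ trans (sum-const (m + n) 0) (ℕ.*-zeroʳ (m + n)) ⟩
      0                           ≤⟨ z≤n ⟩
      d                           ∎

    columns : ∀ a → sum (λ b → edge b a) ≤ d
    columns a = begin
      sum (λ b → edge b a)
        -- By symmetry of `F`, the column of `a` counts the right neighbours of `a`, which are at
        -- most all its neighbours.
        ≡⟨ sum-cong-≗ (λ b → indicator-cong (symm F (m ↑ʳ b) (a ↑ˡ n)) (symm F (a ↑ˡ n) (m ↑ʳ b))) ⟩
      sum (indicator (nbr F (a ↑ˡ n)) ∘ (m ↑ʳ_))
        ≤⟨ ℕ.m≤n+m _ (sum (indicator (nbr F (a ↑ˡ n)) ∘ (_↑ˡ n))) ⟩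
      sum (indicator (nbr F (a ↑ˡ n)) ∘ (_↑ˡ n)) + sum (indicator (nbr F (a ↑ˡ n)) ∘ (m ↑ʳ_))
        ≡⟨ sum-splitAt m (indicator (nbr F (a ↑ˡ n))) ⟨
      sum (indicator (nbr F (a ↑ˡ n)))   ≡⟨ ∣p∣≡sum (nbr F (a ↑ˡ n)) ⟨
      degree ⟨ F ⟩ (a ↑ˡ n)              ≤⟨ degree≤d (a ↑ˡ n) ⟩
      d                                  ∎

  -- Every right vertex lies in some class, and each class meets at most `m` of them.
  n≤k*m : .{{NonZero m}} → ∀ {k} → HasRegularPartition (K m n) k → n ≤ k * m
  n≤k*m {k} (F , P) = begin
    n                   ≡⟨ ℕ.*-identityʳ n ⟨
    n * 1               ≡⟨ sum-const n 1 ⟨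
    sum {n} (λ _ → 1)   ≤⟨ doubleCounting (λ b i → indicator (V ⟨ F i ⟩) (m ↑ʳ b)) rows
                             (λ i → regular⇒∣V∩right∣≤m (F i) (subsets i) (nonempty i) (regular i)) ⟩
    sum {k} (λ _ → m)   ≡⟨ sum-const k m ⟩
    k * m               ∎
    where
    open ℕ.≤-Reasoning
    open IsRegularPartition P

    rows : ∀ b → 1 ≤ sum (λ i → indicator (V ⟨ F i ⟩) (m ↑ʳ b))
    rows b =
      -- Since `m` is nonzero there is a left vertex, and the class covering its edge to `b` has `b`
      -- among its vertices.
      let a      = fromℕ< (ℕ.>-nonZero⁻¹ m)
          i , ab = covers (a ↑ˡ n) (m ↑ʳ b) (∈-select⁺ (opposite? m n (a ↑ˡ n)) (opposite-↑ a b))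
          ba     = symm (F i) (a ↑ˡ n) (m ↑ʳ b) ab
      in begin
        1                               ≡⟨ ∈⇒indicator≡1 (∈-select⁺ (λ u → nonempty? (nbr (F i) u)) (_ , ba)) ⟨
        indicator (V ⟨ F i ⟩) (m ↑ʳ b)  ≤⟨ term≤sum (λ j → indicator (V ⟨ F j ⟩) (m ↑ʳ b)) i ⟩
        sum (λ j → indicator (V ⟨ F j ⟩) (m ↑ʳ b)) ∎

-- Partitions from edge colourings

module _ {m n : ℕ} (χ : Fin m → Fin n → ℕ) where

  -- Stated on the disjoint union so that pattern matching separates the two sides; `splitAt` and
  -- `join` carry it to the vertices of `K m n`.
  Adjacent : ℕ → Fin m ⊎ Fin n → Fin m ⊎ Fin n → Set
  Adjacent c (inj₁ a) (inj₂ b) = χ a b ≡ c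
  Adjacent c (inj₂ b) (inj₁ a) = χ a b ≡ c
  Adjacent c (inj₁ _) (inj₁ _) = ⊥
  Adjacent c (inj₂ _) (inj₂ _) = ⊥

  adjacent? : ∀ c x y → Dec (Adjacent c x y)
  adjacent? c (inj₁ a) (inj₂ b) = χ a b ℕ.≟ c
  adjacent? c (inj₂ b) (inj₁ a) = χ a b ℕ.≟ c
  adjacent? c (inj₁ _) (inj₁ _) = no id
  adjacent? c (inj₂ _) (inj₂ _) = no id

  adjacent-irrefl : ∀ c x → ¬ Adjacent c x x
  adjacent-irrefl c (inj₁ _) = id
  adjacent-irrefl c (inj₂ _) = id

  adjacent-sym : ∀ c x y → Adjacent c x y → Adjacent c y x
  adjacent-sym c (inj₁ _) (inj₂ _) = id
  adjacent-sym c (inj₂ _) (inj₁ _) = id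

  adjacent-unique : ∀ {c c′} x y → Adjacent c x y → Adjacent c′ x y → c ≡ c′
  adjacent-unique (inj₁ _) (inj₂ _) refl refl = refl
  adjacent-unique (inj₂ _) (inj₁ _) refl refl = refl

  opposite-sym : ∀ {u v} → Opposite m n u v → Opposite m n v u
  opposite-sym (inj₁ (p , q)) = inj₂ (q , p)
  opposite-sym (inj₂ (p , q)) = inj₁ (q , p)

  adjacent⇒opposite : ∀ c x y → Adjacent c x y → Opposite m n (join m n x) (join m n y)
  adjacent⇒opposite c (inj₁ a) (inj₂ b) _ = opposite-↑ a b
  adjacent⇒opposite c (inj₂ b) (inj₁ a) _ = opposite-sym (opposite-↑ a b)

  opposite⇒adjacent : ∀ x y → Opposite m n (join m n x) (join m n y) →
    ∃[ a ] ∃[ b ] Adjacent (χ a b) x y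
  opposite⇒adjacent (inj₁ a) (inj₂ b)  _ = a , b , refl
  opposite⇒adjacent (inj₂ b) (inj₁ a)  _ = a , b , refl
  opposite⇒adjacent (inj₁ a) (inj₁ a′) o = contradiction o (¬opposite-↑ˡ a a′)
  opposite⇒adjacent (inj₂ b) (inj₂ b′) o = contradiction o (¬opposite-↑ʳ b b′)

  colourClass : ℕ → EdgeSet (m + n)
  colourClass c = record
    { nbr    = λ u → select (adj? u)
    ; irrefl = λ u uu → adjacent-irrefl c (splitAt m u) (∈-select⁻ (adj? u) uu)
    ; symm   = λ u v uv → ∈-select⁺ (adj? v)
        (adjacent-sym c (splitAt m u) (splitAt m v) (∈-select⁻ (adj? u) uv))
    }
    where adj? = λ u v → adjacent? c (splitAt m u) (splitAt m v)

  ∈-colourClass⁺ : ∀ {c} u v → Adjacent c (splitAt m u) (splitAt m v) → u — v ∈ colourClass c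
  ∈-colourClass⁺ {c} u v = ∈-select⁺ (λ v → adjacent? c (splitAt m u) (splitAt m v))

  ∈-colourClass⁻ : ∀ {c} u v → u — v ∈ colourClass c → Adjacent c (splitAt m u) (splitAt m v)
  ∈-colourClass⁻ {c} u v = ∈-select⁻ (λ v → adjacent? c (splitAt m u) (splitAt m v))

  -- Only endpoints of edges of colour `c` are constrained, as befits an edge-induced subgraph; an
  -- absent colour satisfies this for every `d`.
  RegularColour : ℕ → ℕ → Set
  RegularColour d c = ∀ a b → χ a b ≡ c →
    Enumeration d (λ b′ → χ a b′ ≡ c) × Enumeration d (λ a′ → χ a′ b ≡ c)

  enumerateNeighbours : ∀ {d c} → RegularColour d c → ∀ x y → Adjacent c x y →
    Enumeration d (Adjacent c x)
  enumerateNeighbours R (inj₁ a) (inj₂ b) ab = record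
    { element   = inj₂ ∘ element D
    ; injective = injective D ∘ inj₂-injective
    ; sound     = sound D
    ; complete  = λ { {inj₂ _} ab′ → let t , eq = complete D ab′ in t , cong inj₂ eq }
    }
    where D = proj₁ (R a b ab)
  enumerateNeighbours R (inj₂ b) (inj₁ a) ab = record
    { element   = inj₁ ∘ element D
    ; injective = injective D ∘ inj₁-injective
    ; sound     = sound D
    ; complete  = λ { {inj₁ _} ab′ → let t , eq = complete D ab′ in t , cong inj₁ eq }
    }
    where D = proj₂ (R a b ab)

  enumerate-join : ∀ {d} {P : Fin m ⊎ Fin n → Set} → Enumeration d P → Enumeration d (P ∘ splitAt m)
  enumerate-join {P = P} D = record
    { element   = join m n ∘ element D
    ; injective = λ {s} {t} eq → injective D (trans (sym (Fin.splitAt-join m n (element D s)))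
        (trans (cong (splitAt m) eq) (Fin.splitAt-join m n (element D t))))
    ; sound     = λ t → subst P (sym (Fin.splitAt-join m n (element D t))) (sound D t)
    ; complete  = λ {u} pu → let t , eq = complete D pu in
        t , trans (cong (join m n) eq) (Fin.join-splitAt m n u)
    }

  degree-colourClass : ∀ {d c} → RegularColour d c → ∀ u → u ∈ V ⟨ colourClass c ⟩ →
    degree ⟨ colourClass c ⟩ u ≡ d
  degree-colourClass {c = c} R u u∈V =
    let v , uv = ∈-select⁻ (λ u → nonempty? (nbr (colourClass c) u)) u∈V
    in ∣select∣ (λ v → adjacent? c (splitAt m u) (splitAt m v))
         (enumerate-join (enumerateNeighbours R (splitAt m u) (splitAt m v) (∈-colourClass⁻ u v uv)))

  -- The bound on the colours gives covering, surjectivity onto the colours below `k` gives nonempty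
  -- classes, and disjointness holds because an edge has only one colour. The degree may vary with
  -- the colour.
  colouring⇒partition : ∀ {k} →
    (∀ a b → χ a b < k) →
    (∀ {c} → c < k → ∃[ a ] ∃[ b ] χ a b ≡ c) →
    (∀ c → ∃[ d ] RegularColour d c) →
    HasRegularPartition (K m n) k
  colouring⇒partition {k} χ<k onto reg = colourClass ∘ toℕ , record
    { subsets  = λ i u v uv → ∈-select⁺ (opposite? m n u)
        (subst₂ (Opposite m n) (Fin.join-splitAt m n u) (Fin.join-splitAt m n v)
          (adjacent⇒opposite (toℕ i) (splitAt m u) (splitAt m v) (∈-colourClass⁻ u v uv)))
    ; nonempty = λ i → let a , b , eq = onto (Fin.toℕ<n i) in
        a ↑ˡ n , m ↑ʳ b , ∈-colourClass⁺ (a ↑ˡ n) (m ↑ʳ b)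
          (subst₂ (Adjacent (toℕ i)) (sym (Fin.splitAt-↑ˡ m a n)) (sym (Fin.splitAt-↑ʳ m n b)) eq)
    ; disjoint = λ i j u v p q → Fin.toℕ-injective
        (adjacent-unique (splitAt m u) (splitAt m v) (∈-colourClass⁻ u v p) (∈-colourClass⁻ u v q))
    ; covers   = λ u v uv →
        let a , b , ab = opposite⇒adjacent (splitAt m u) (splitAt m v)
              (subst₂ (Opposite m n) (sym (Fin.join-splitAt m n u)) (sym (Fin.join-splitAt m n v))
                (∈-select⁻ (opposite? m n u) uv))
        in fromℕ< (χ<k a b) , ∈-colourClass⁺ u v
             (subst (λ c → Adjacent c (splitAt m u) (splitAt m v)) (sym (Fin.toℕ-fromℕ< (χ<k a b))) ab)
    ; regular  = λ i u v u∈ v∈ → let _ , R = reg (toℕ i) in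
        trans (degree-colourClass R u u∈) (sym (degree-colourClass R v v∈))
    }

-- The colouring by blocks and matchings

module _ (m : ℕ) .{{_ : NonZero m}} where

  -- The equal remainders cancel, so the distance is a multiple of `m`; being less than `m`, it is
  -- 0.
  %-≡⇒≡ : ∀ {x y} → x % m ≡ y % m → ∣ x - y ∣ < m → x ≡ y
  %-≡⇒≡ {x} {y} eq lt = ℕ.∣m-n∣≡0⇒m≡n (trans distance (cong (_* m) (ℕ.n<1⇒n≡0
    (ℕ.*-cancelʳ-< m ∣ x ℕ./ m - y ℕ./ m ∣ 1 (subst₂ _<_ distance (sym (ℕ.*-identityˡ m)) lt)))))
    where
    open ≡-Reasoning
    distance : ∣ x - y ∣ ≡ ∣ x ℕ./ m - y ℕ./ m ∣ * m
    distance = begin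
      ∣ x - y ∣                                       ≡⟨ cong₂ ∣_-_∣ (m≡m%n+[m/n]*n x m) (m≡m%n+[m/n]*n y m) ⟩
      ∣ x % m + x ℕ./ m * m - y % m + y ℕ./ m * m ∣   ≡⟨ cong (λ r → ∣ x % m + x ℕ./ m * m - r + y ℕ./ m * m ∣) eq ⟨
      ∣ x % m + x ℕ./ m * m - x % m + y ℕ./ m * m ∣   ≡⟨ ℕ.∣m+n-m+o∣≡∣n-o∣ (x % m) _ _ ⟩
      ∣ x ℕ./ m * m - y ℕ./ m * m ∣                   ≡⟨ ℕ.*-distribʳ-∣-∣ m (x ℕ./ m) (y ℕ./ m) ⟨
      ∣ x ℕ./ m - y ℕ./ m ∣ * m                       ∎

  ∣-∣-< : ∀ {x y} → x < m → y < m → ∣ x - y ∣ < m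
  ∣-∣-< {x} {y} x<m y<m = ℕ.≤-<-trans (ℕ.∣m-n∣≤m⊔n x y) (ℕ.⊔-pres-<m x<m y<m)

  [t+i*m]/m≡i : ∀ {t} i → t < m → (t + i * m) ℕ./ m ≡ i
  [t+i*m]/m≡i {t} i t<m = trans (+-distrib-/-∣ʳ t (n∣m*n i)) (cong₂ _+_ (m<n⇒m/n≡0 t<m) (m*n/n≡m i m))

  t+i*m<n : ∀ {t i n} → t < m → i < n ℕ./ m → t + i * m < n
  t+i*m<n {t} {i} {n} t<m i<q = begin-strict
    t + i * m       <⟨ ℕ.+-monoˡ-< (i * m) t<m ⟩
    suc i * m       ≤⟨ ℕ.*-monoˡ-≤ m i<q ⟩
    n ℕ./ m * m     ≤⟨ m/n*n≤m n m ⟩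
    n               ∎
    where open ℕ.≤-Reasoning

  module _ (n : ℕ) where

    q = n ℕ./ m

    -- Colours below `q` are block numbers; colours `q + s` with `s < m` are the matchings. For
    -- `b < n`, lying outside the full blocks means having quotient exactly `q`.
    colour : ℕ → ℕ → ℕ
    colour a b with b ℕ./ m ℕ.<? q
    ... | yes _ = b ℕ./ m
    ... | no  _ = q + (a + b) % m

    colour-block : ∀ a {b} → b ℕ./ m < q → colour a b ≡ b ℕ./ m
    colour-block a {b} lt with b ℕ./ m ℕ.<? q
    ... | yes _  = refl
    ... | no ≮q = contradiction lt ≮q

    colour-matching : ∀ a {b} → ¬ b ℕ./ m < q → colour a b ≡ q + (a + b) % m
    colour-matching a {b} ≮q with b ℕ./ m ℕ.<? q
    ... | yes lt = contradiction lt ≮q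
    ... | no _   = refl

    -- Matching colours start at `q`, so a smaller colour reveals the block.
    colour<q : ∀ a b → colour a b < q → b ℕ./ m ≡ colour a b
    colour<q a b lt with b ℕ./ m ℕ.<? q
    ... | yes _ = refl
    ... | no _  = contradiction lt (ℕ.m+n≮m q _)

    colour≮q : ∀ a b → ¬ colour a b < q → ¬ b ℕ./ m < q
    colour≮q a b ≮q lt = ≮q (subst (_< q) (sym (colour-block a lt)) lt)

    χ : Fin m → Fin n → ℕ
    χ a b = colour (toℕ a) (toℕ b)

    -- Right vertices outside the full blocks all have quotient `q`, so they differ only in their
    -- remainders.
    ∣b-b′∣<m : ∀ (b b′ : Fin n) → ¬ toℕ b ℕ./ m < q → ¬ toℕ b′ ℕ./ m < q → ∣ toℕ b - toℕ b′ ∣ < m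
    ∣b-b′∣<m b b′ ≮q ≮q′ = subst (_< m) (sym (begin
      ∣ toℕ b - toℕ b′ ∣                        ≡⟨ cong₂ ∣_-_∣ (split b ≮q) (split b′ ≮q′) ⟩
      ∣ q * m + toℕ b % m - q * m + toℕ b′ % m ∣ ≡⟨ ℕ.∣m+n-m+o∣≡∣n-o∣ (q * m) _ _ ⟩
      ∣ toℕ b % m - toℕ b′ % m ∣                 ∎)) (∣-∣-< (m%n<n (toℕ b) m) (m%n<n (toℕ b′) m))
      where
      open ≡-Reasoning
      split : ∀ (b : Fin n) → ¬ toℕ b ℕ./ m < q → toℕ b ≡ q * m + toℕ b % m
      split b ≮q = begin
        toℕ b                           ≡⟨ m≡m%n+[m/n]*n (toℕ b) m ⟩
        toℕ b % m + toℕ b ℕ./ m * m     ≡⟨ ℕ.+-comm (toℕ b % m) _ ⟩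
        toℕ b ℕ./ m * m + toℕ b % m
          ≡⟨ cong (λ j → j * m + toℕ b % m)
               (ℕ.≤-antisym (/-monoˡ-≤ m (ℕ.<⇒≤ (Fin.toℕ<n b))) (ℕ.≮⇒≥ ≮q)) ⟩
        q * m + toℕ b % m               ∎

    -- In colour `c`, a left vertex has as neighbours the `m` vertices `t + c * m` of the block; a
    -- vertex of the block is joined to all `m` left vertices, because the colour of a block edge
    -- does not depend on its left end.
    block-regular : ∀ {c} → c < q → RegularColour χ m c
    block-regular {c} c<q a b ab = record
      { element   = λ t → fromℕ< (t<n t)
      ; injective = λ {s} {t} eq → Fin.toℕ-injective (ℕ.+-cancelʳ-≡ (c * m) _ _
          (trans (sym (Fin.toℕ-fromℕ< (t<n s))) (trans (cong toℕ eq) (Fin.toℕ-fromℕ< (t<n t)))))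
      ; sound     = λ t → block a (trans (cong (ℕ._/ m) (Fin.toℕ-fromℕ< (t<n t))) ([t+i*m]/m≡i c (Fin.toℕ<n t)))
      -- As `b′` has quotient `c`, its remainder is its position in the block.
      ; complete  = λ {b′} ab′ → fromℕ< (m%n<n (toℕ b′) m) , Fin.toℕ-injective
          (trans (Fin.toℕ-fromℕ< (t<n _))
            (trans (cong₂ (λ t i → t + i * m) (Fin.toℕ-fromℕ< (m%n<n (toℕ b′) m)) (sym (quotient≡c a b′ ab′)))
              (sym (m≡m%n+[m/n]*n (toℕ b′) m))))
      } , record
      { element   = id
      ; injective = id
      ; sound     = λ a′ → block a′ (quotient≡c a b ab)
      ; complete  = λ {a′} _ → a′ , refl
      }
      where
      t<n : ∀ (t : Fin m) → toℕ t + c * m < n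
      t<n t = t+i*m<n (Fin.toℕ<n t) c<q

      block : ∀ a {b} → toℕ b ℕ./ m ≡ c → χ a b ≡ c
      block a eq = trans (colour-block (toℕ a) (subst (_< q) (sym eq) c<q)) eq

      quotient≡c : ∀ a b → χ a b ≡ c → toℕ b ℕ./ m ≡ c
      quotient≡c a b eq = trans (colour<q (toℕ a) (toℕ b) (subst (_< q) (sym eq) c<q)) eq

    -- Edges of one matching colour have congruent sums modulo `m`. With one end fixed, two
    -- candidates for the other end are congruent and less than `m` apart, hence equal.
    matching-regular : ∀ {c} → ¬ c < q → RegularColour χ 1 c
    matching-regular {c} c≮q a b ab = singleton b ab uniqueʳ , singleton a ab uniqueˡ
      where
      singleton : ∀ {N} {P : Fin N → Set} x → P x → (∀ {y} → P y → x ≡ y) → Enumeration 1 P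
      singleton x px unique = record
        { element   = λ _ → x
        ; injective = λ { {zero} {zero} _ → refl }
        ; sound     = λ _ → px
        ; complete  = λ py → zero , unique py
        }

      b≮q : ∀ {a b} → χ a b ≡ c → ¬ toℕ b ℕ./ m < q
      b≮q {a} {b} eq = colour≮q (toℕ a) (toℕ b) (c≮q ∘ subst (_< q) eq)

      residue : ∀ {a b a′ b′} → χ a b ≡ c → χ a′ b′ ≡ c → (toℕ a + toℕ b) % m ≡ (toℕ a′ + toℕ b′) % m
      residue {a} {b} {a′} {b′} ab a′b′ = ℕ.+-cancelˡ-≡ q _ _
        (trans (sym (colour-matching (toℕ a) (b≮q ab)))
          (trans (trans ab (sym a′b′)) (colour-matching (toℕ a′) (b≮q a′b′))))

      uniqueʳ : ∀ {b′} → χ a b′ ≡ c → b ≡ b′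
      uniqueʳ {b′} ab′ = Fin.toℕ-injective (ℕ.+-cancelˡ-≡ (toℕ a) _ _
        (%-≡⇒≡ (residue ab ab′)
          (subst (_< m) (sym (ℕ.∣m+n-m+o∣≡∣n-o∣ (toℕ a) _ _)) (∣b-b′∣<m b b′ (b≮q ab) (b≮q ab′)))))

      uniqueˡ : ∀ {a′} → χ a′ b ≡ c → a ≡ a′
      uniqueˡ {a′} a′b = Fin.toℕ-injective (ℕ.+-cancelˡ-≡ (toℕ b) _ _
        -- The sums are commuted to put the fixed `b` in front, where it cancels from the distance.
        (%-≡⇒≡ (subst₂ (λ x y → x % m ≡ y % m) (ℕ.+-comm (toℕ a) _) (ℕ.+-comm (toℕ a′) _) (residue ab a′b))
          (subst (_< m) (sym (ℕ.∣m+n-m+o∣≡∣n-o∣ (toℕ b) _ _)) (∣-∣-< (Fin.toℕ<n a) (Fin.toℕ<n a′)))))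

    χ-regular : ∀ c → ∃[ d ] RegularColour χ d c
    χ-regular c with c ℕ.<? q
    ... | yes c<q = m , block-regular c<q
    ... | no  c≮q = 1 , matching-regular c≮q

    block-onto : ∀ {c} → c < q → ∃[ a ] ∃[ b ] χ a b ≡ c
    -- The witnesses are left vertex 0 and the first vertex `c * m` of block `c`.
    block-onto {c} c<q = fromℕ< m>0 , fromℕ< b<n ,
      trans (colour-block _ (subst (_< q) (sym quot) c<q)) quot
      where
      m>0 = ℕ.>-nonZero⁻¹ m
      b<n = t+i*m<n m>0 c<q

      quot : toℕ (fromℕ< b<n) ℕ./ m ≡ c
      quot = trans (cong (ℕ._/ m) (Fin.toℕ-fromℕ< b<n)) ([t+i*m]/m≡i c m>0)

    -- Here `n = q * m`, so every right vertex lies in a full block and no matching colour occurs.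
    partition-∣ : m ∣ n → HasRegularPartition (K m n) q
    partition-∣ m∣n = colouring⇒partition χ
      (λ a b → subst (_< q) (sym (colour-block (toℕ a) (b<q b))) (b<q b)) block-onto χ-regular
      where
      b<q : ∀ (b : Fin n) → toℕ b ℕ./ m < q
      b<q b = m<n*o⇒m/o<n (subst (toℕ b <_) (sym (m/n*n≡m m∣n)) (Fin.toℕ<n b))

    -- Non-divisibility makes the matching classes nonempty: vertex `q * m` is left over, and its
    -- `m` edges carry all `m` matching colours.
    partition-∤ : ¬ m ∣ n → HasRegularPartition (K m n) (q + m)
    partition-∤ m∤n = colouring⇒partition χ (λ a b → bounded (toℕ a) (toℕ b)) onto χ-regular
      where
      bounded : ∀ a b → colour a b < q + m
      bounded a b with b ℕ./ m ℕ.<? q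
      ... | yes lt = ℕ.<-≤-trans lt (ℕ.m≤m+n q m)
      ... | no _   = ℕ.+-monoʳ-< q (m%n<n (a + b) m)

      q*m<n : q * m < n
      q*m<n = ℕ.≤∧≢⇒< (m/n*n≤m n m) (λ eq → m∤n (divides q (sym eq)))

      onto : ∀ {c} → c < q + m → ∃[ a ] ∃[ b ] χ a b ≡ c
      onto {c} c<q+m with c ℕ.<? q
      ... | yes c<q = block-onto c<q
      -- At `b = q * m` the sum is congruent to `a`, so `a = c ∸ q` produces the colour `c`.
      ... | no  c≮q = fromℕ< a<m , fromℕ< q*m<n , (begin
        colour (toℕ (fromℕ< a<m)) (toℕ (fromℕ< q*m<n))
          ≡⟨ cong₂ colour (Fin.toℕ-fromℕ< a<m) (Fin.toℕ-fromℕ< q*m<n) ⟩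
        colour (c ℕ.∸ q) (q * m)   ≡⟨ colour-matching (c ℕ.∸ q) (λ lt → ℕ.<-irrefl (m*n/n≡m q m) lt) ⟩
        q + (c ℕ.∸ q + q * m) % m  ≡⟨ cong (λ r → q + r) ([m+kn]%n≡m%n (c ℕ.∸ q) q m) ⟩
        q + (c ℕ.∸ q) % m          ≡⟨ cong (λ r → q + r) (m<n⇒m%n≡m a<m) ⟩
        q + (c ℕ.∸ q)              ≡⟨ ℕ.m+[n∸m]≡n (ℕ.≮⇒≥ c≮q) ⟩
        c                          ∎)
        where
        open ≡-Reasoning
        a<m : c ℕ.∸ q < m
        a<m = ℕ.+-cancelˡ-< q _ _ (subst (_< q + m) (sym (ℕ.m+[n∸m]≡n (ℕ.≮⇒≥ c≮q))) c<q+m)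

-- Floor and ceiling of `n / m`

⌈n/m⌉≤k : ∀ {n k m} .{{_ : NonZero m}} → n ≤ k * m → ⌈ + n / m ⌉ ℤ.≤ + k
⌈n/m⌉≤k {n} {k} {m@(suc _)} n≤k*m = begin
  ℤ.- (ℤ.- + n ℤ./ + m)    ≡⟨ cong ℤ.-_ (ℤ.div-pos-is-/ℕ (ℤ.- + n) m) ⟩
  ℤ.- (ℤ.- + n ℤ./ℕ m)     ≤⟨ ℤ.neg-mono-≤ -k≤ ⟩
  ℤ.- (ℤ.- + k)            ≡⟨ ℤ.neg-involutive (+ k) ⟩
  + k                      ∎
  where
  open ℤ.≤-Reasoning
  -- The ceiling is the negated floor of `- n / m`. Proving the bound as `- k < floor + 1` allows
  -- multiplying by `m`, which leaves `- (k * m) ≤ - n < (floor + 1) * m`.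
  -k≤ : ℤ.- + k ℤ.≤ ℤ.- + n ℤ./ℕ m
  -k≤ = subst (ℤ.- + k ℤ.≤_) (ℤ.pred-suc _) (ℤ.i<j⇒i≤pred[j] (ℤ.*-cancelʳ-<-nonNeg {j = ℤ.suc (ℤ.- + n ℤ./ℕ m)} (+ m) (begin-strict
    ℤ.- + k ℤ.* + m                           ≡⟨ ℤ.neg-distribˡ-* (+ k) (+ m) ⟨
    ℤ.- (+ k ℤ.* + m)                         ≡⟨ cong ℤ.-_ (ℤ.pos-* k m) ⟨
    ℤ.- + (k * m)                             ≤⟨ ℤ.neg-mono-≤ (ℤ.+≤+ n≤k*m) ⟩
    ℤ.- + n                                   <⟨ ℤ.n<s[n/ℕd]*d (ℤ.- + n) m ⟩
    ℤ.suc (ℤ.- + n ℤ./ℕ m) ℤ.* + m            ∎)))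

⌊n/m⌋≡n/m : ∀ n m .{{_ : NonZero m}} → ⌊ + n / m ⌋ ≡ + (n ℕ./ m)
⌊n/m⌋≡n/m n m@(suc _) = ℤ.div-pos-is-/ℕ (+ n) m

k/1≃n/m : ∀ {n k m} .{{_ : NonZero m}} → k * m ≡ n → + k / 1 ≃ + n / m
k/1≃n/m {n} {k} {m@(suc _)} eq = *≡* (begin
  + k ℤ.* + m    ≡⟨ ℤ.pos-* k m ⟨
  + (k * m)      ≡⟨ cong +_ eq ⟩
  + n            ≡⟨ ℤ.*-identityʳ (+ n) ⟨
  + n ℤ.* + 1    ∎)
  where open ≡-Reasoning

proposition3 : ∀ (m n : ℕ) .{{_ : NonZero m}} .{{_ : NonZero n}} → m ≤ n →
    ((⌈ + n / m ⌉ ℤ.≤ + regularNumber (K m n)) ×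
    (+ regularNumber (K m n) ℤ.≤ ⌊ + n / m ⌋ ℤ.+ + m)) ×
    (m ∣ n → + regularNumber (K m n) / 1 ≃ + n / m)
proposition3 m n _ = (⌈n/m⌉≤k n≤r*m , upper) , λ m∣n → k/1≃n/m (ℕ.≤-antisym
    -- The block partition gives `r * m ≤ (n / m) * m ≤ n`; with `n ≤ r * m` this yields
    -- `r * m ≡ n`.
    (ℕ.≤-trans (ℕ.*-monoˡ-≤ m (minimal _ (partition-∣ m n m∣n))) (m/n*n≤m n m)) n≤r*m)
  where
  r = regularNumber (K m n)
  minimal = proj₂ (regularNumber-isRegularNumber (K m n))

  n≤r*m : n ≤ r * m
  n≤r*m = n≤k*m (proj₁ (regularNumber-isRegularNumber (K m n)))

  r≤ : r ≤ n ℕ./ m + m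
  -- If `m` divides `n`, the matching classes would be empty, so the partition into `n / m` blocks
  -- is used and its bound weakened.
  r≤ with m ∣? n
  ... | yes m∣n = ℕ.≤-trans (minimal _ (partition-∣ m n m∣n)) (ℕ.m≤m+n _ m)
  ... | no  m∤n = minimal _ (partition-∤ m n m∤n)

  upper : + r ℤ.≤ ⌊ + n / m ⌋ ℤ.+ + m
  upper = subst (λ z → + r ℤ.≤ z ℤ.+ + m) (sym (⌊n/m⌋≡n/m n m)) (ℤ.+≤+ r≤)
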